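{- There exist a large set with multiplicity LS$(4,5,11;\mu)$ and a large set with multiplicity LS$(5,6,12;\mu)$ for each integer $\mu\geq 2$, with possible exceptions when $\mu\in\{3,5,7,9,11,13\}$.
   Context: A Steiner system S$(t,k,n)$ is a pair $(Q,B)$ where $Q$ is an $n$-set and $B$ is a collection of $k$-subsets (blocks) of $Q$ such that every $t$-subset of $Q$ is contained in exactly one block. A large set with multiplicity $\mu$, LS$(t,k,n;\mu)$, is a family (the same system may occur more than once) of Steiner systems S$(t,k,n)$ on a common $n$-set $Q$ such that every $k$-subset of $Q$ is a block of exactly $\mu$ of the systems. -}

module Defs where

open import Data.Fin.Subset using (Subset; _⊆_; ∣_∣)
open import Data.List using (List; length; filter)
open import Data.Nat using (ℕ)
open import Data.Product using (∃!; _×_)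
open import Level using (0ℓ)
open import Relation.Binary.PropositionalEquality using (_≡_)
open import Relation.Unary using (Pred; Decidable)

-- The underlying n-set is Fin n.  Decidability makes the blocks an honest
-- finite set of subsets, so that systems containing a given block can be counted.
record SteinerSystem (t k n : ℕ) : Set₁ where
  field
    Block      : Pred (Subset n) 0ℓ
    block?     : Decidable Block
    block-size : ∀ {b} → Block b → ∣ b ∣ ≡ k
    covering   : ∀ (s : Subset n) → ∣ s ∣ ≡ t → ∃! _≡_ λ b → Block b × s ⊆ b

open SteinerSystem public

-- A list of systems, since the same system may occur more than once.
record LargeSet (t k n μ : ℕ) : Set₁ where
  field
    systems      : List (SteinerSystem t k n)
    multiplicity : ∀ (b : Subset n) → ∣ b ∣ ≡ k →
                   length (filter (λ S → block? S b) systems) ≡ μ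

open LargeSet public

{-# OPTIONS --safe #-}
-- Large sets on a common point set add up, so multiplicities 2 and 15 give all
-- even ones and all odd ones from 15 on.  Deriving every system at a point turns
-- an LS(5,6,12;μ) into an LS(4,5,11;μ), because the 5-subsets of the remaining
-- points correspond to the 6-subsets containing that point.  Both large sets on
-- 12 points consist of relabellings of the S(5,6,12) on the projective line over
-- the field with 11 elements, and evaluation checks them.  For μ = 2 they are that
-- system, twice its image under x ↦ −x, and the 11 translates of a third system;
-- for μ = 15 they form one orbit of a group of order 105 acting semiregularly on
-- the systems.

module Submission where

open import Data.Nat using (ℕ; _≤_)
open import Data.List using (_∷_; [])
open import Data.List.Membership.Propositional using (_∉_)
open import Data.Product using (_×_)
open import Defs

import Algebra.Properties.CommutativeMonoid.Sum as Sum
open import Data.Bool using (Bool; true; false; T; not; _∧_; _∨_)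
open import Data.Bool.Properties using (T-≡)
open import Data.Empty using (⊥-elim)
open import Data.Fin using (Fin; #_)
open import Data.Fin.Permutation as Perm
  using (Permutation′; _⟨$⟩ʳ_; _∘ₚ_; flip; transpose)
open import Data.Fin.Subset using (Subset; _⊆_; ∣_∣; ∁; ⁅_⁆; ⋃)
open import Data.Fin.Subset.Properties using (drop-∷-⊆; out⊆; s⊆s; ⊆-refl)
open import Data.List as List
  using (List; _++_; length; filter; cartesianProductWith)
open import Data.List.Membership.Propositional using (_∈_)
open import Data.List.Membership.Propositional.Properties
  using (∈-map⁺; ∈-map⁻; ∈-++⁺ˡ; ∈-++⁺ʳ; ∈-++⁻)
open import Data.List.Properties using (filter-++; length-++)
open import Data.List.Relation.Unary.Any using (here; there)
open import Data.Nat using (zero; suc; _+_; _*_; _≡ᵇ_)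
open import Data.Nat.Properties using (+-0-commutativeMonoid; ≡⇒≡ᵇ; ≡ᵇ⇒≡; <⇒≢; suc-injective)
open import Data.Product using (∃; ∃!; _,_)
open import Data.Sum using (_⊎_; inj₁; inj₂)
open import Data.Vec as Vec using (Vec; []; _∷_; lookup; tabulate)
open import Data.Vec.Properties
  using (lookup-map; lookup∘tabulate; tabulate∘lookup; tabulate-cong; lookup⇒[]=; []=⇒lookup)
open import Function using (_∘_; Equivalence)
open import Relation.Nullary using (does)
open import Relation.Nullary.Decidable using (T?)
open import Relation.Binary.PropositionalEquality
  using (_≡_; refl; sym; trans; cong; cong₂; subst; module ≡-Reasoning)

open Sum +-0-commutativeMonoid using (sum; sum-permute; sum-cong-≗)

private variable
  n t k μ ν : ℕ

-- Sums of large sets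

emptyLargeSet : LargeSet t k n 0
emptyLargeSet .systems      = []
emptyLargeSet .multiplicity = λ _ _ → refl

_⊎ᴸ_ : LargeSet t k n μ → LargeSet t k n ν → LargeSet t k n (μ + ν)
(L ⊎ᴸ M) .systems = systems L ++ systems M
(L ⊎ᴸ M) .multiplicity b ∣b∣≡k = begin
  length (filter P? (systems L ++ systems M))
    ≡⟨ cong length (filter-++ P? (systems L) (systems M)) ⟩
  length (filter P? (systems L) ++ filter P? (systems M))
    ≡⟨ length-++ (filter P? (systems L)) ⟩
  length (filter P? (systems L)) + length (filter P? (systems M))
    ≡⟨ cong₂ _+_ (multiplicity L b ∣b∣≡k) (multiplicity M b ∣b∣≡k) ⟩
  _ ∎
  where
  open ≡-Reasoning
  P? = λ S → block? S b

_×ᴸ_ : ∀ m → LargeSet t k n μ → LargeSet t k n (m * μ)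
zero  ×ᴸ L = emptyLargeSet
suc m ×ᴸ L = L ⊎ᴸ (m ×ᴸ L)

-- Derivation at a point

derived : SteinerSystem (suc t) (suc k) (suc n) → SteinerSystem t k n
derived S .Block  b  = Block S (true ∷ b)
derived S .block? b  = block? S (true ∷ b)
derived S .block-size = suc-injective ∘ block-size S
derived S .covering s ∣s∣≡t with covering S (true ∷ s) (cong suc ∣s∣≡t)
-- The block covers `true ∷ s`, so it contains the deleted point.
... | false ∷ b , (_ , s⊆b) , _ with () ← []=⇒lookup (s⊆b Vec.here)
... | true ∷ b , (Bb , s⊆b) , unique =
  b , (Bb , drop-∷-⊆ s⊆b) , λ (Bc , s⊆c) → cong Vec.tail (unique (Bc , s⊆s s⊆c))

length-filter-derived : ∀ (b : Subset n) (Ss : List (SteinerSystem (suc t) (suc k) (suc n))) →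
  length (filter (λ S → block? S b) (List.map derived Ss)) ≡
  length (filter (λ S → block? S (true ∷ b)) Ss)
length-filter-derived b [] = refl
length-filter-derived b (S ∷ Ss) with does (block? S (true ∷ b))
... | true  = cong suc (length-filter-derived b Ss)
... | false = length-filter-derived b Ss

derivedᴸ : LargeSet (suc t) (suc k) (suc n) μ → LargeSet t k n μ
derivedᴸ L .systems = List.map derived (systems L)
derivedᴸ L .multiplicity b ∣b∣≡k =
  trans (length-filter-derived b (systems L)) (multiplicity L (true ∷ b) (cong suc ∣b∣≡k))

-- Relabelling of systems

image : Permutation′ n → Vec (Fin n) n
image π = tabulate (π ⟨$⟩ʳ_)

-- Going through the table `image π` makes this agree by definition with the term evaluated in
-- `occurrences`, where one table serves all subsets.
preimage : Permutation′ n → Subset n → Subset n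
preimage π b = Vec.map (lookup b) (image π)

lookup-preimage : ∀ (π : Permutation′ n) b i → lookup (preimage π b) i ≡ lookup b (π ⟨$⟩ʳ i)
lookup-preimage π b i =
  trans (lookup-map i (lookup b) (image π)) (cong (lookup b) (lookup∘tabulate (π ⟨$⟩ʳ_) i))

lookup-extensional : ∀ {b c : Subset n} → (∀ i → lookup b i ≡ lookup c i) → b ≡ c
lookup-extensional {b = b} {c} eq =
  trans (sym (tabulate∘lookup b)) (trans (tabulate-cong eq) (tabulate∘lookup c))

preimage-flip : ∀ (π : Permutation′ n) b → preimage π (preimage (flip π) b) ≡ b
preimage-flip π b = lookup-extensional λ i →
  trans (lookup-preimage π (preimage (flip π) b) i)
  (trans (lookup-preimage (flip π) b (π ⟨$⟩ʳ i)) (cong (lookup b) (Perm.inverseˡ π)))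

preimage-⊆ : ∀ (π : Permutation′ n) {b c} → b ⊆ c → preimage π b ⊆ preimage π c
preimage-⊆ π {b} {c} b⊆c {i} i∈ = lookup⇒[]= i _
  (trans (lookup-preimage π c i) ([]=⇒lookup (b⊆c (lookup⇒[]= _ b
    (trans (sym (lookup-preimage π b i)) ([]=⇒lookup i∈))))))

indicator : Bool → ℕ
indicator true  = 1
indicator false = 0

-- A sum over positions is invariant under permuting them, which yields `∣preimage∣`.
∣b∣≡sum : ∀ (b : Subset n) → ∣ b ∣ ≡ sum (indicator ∘ lookup b)
∣b∣≡sum []          = refl
∣b∣≡sum (true  ∷ b) = cong suc (∣b∣≡sum b)
∣b∣≡sum (false ∷ b) = ∣b∣≡sum b

∣preimage∣ : ∀ (π : Permutation′ n) b → ∣ preimage π b ∣ ≡ ∣ b ∣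
∣preimage∣ π b = begin
  ∣ preimage π b ∣                          ≡⟨ ∣b∣≡sum (preimage π b) ⟩
  sum (indicator ∘ lookup (preimage π b))   ≡⟨ sum-cong-≗ (cong indicator ∘ lookup-preimage π b) ⟩
  sum (indicator ∘ lookup b ∘ (π ⟨$⟩ʳ_))    ≡⟨ sum-permute (indicator ∘ lookup b) π ⟨
  sum (indicator ∘ lookup b)                ≡⟨ ∣b∣≡sum b ⟨
  ∣ b ∣                                     ∎
  where open ≡-Reasoning

-- The blocks of relabel π S are the images under π of the blocks of S.
relabel : Permutation′ n → SteinerSystem t k n → SteinerSystem t k n
relabel π S .Block  b = Block S (preimage π b)
relabel π S .block? b = block? S (preimage π b)
relabel π S .block-size {b} B = trans (sym (∣preimage∣ π b)) (block-size S B)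
relabel π S .covering s ∣s∣≡t
  with b , (Bb , s⊆b) , unique ← covering S (preimage π s) (trans (∣preimage∣ π s) ∣s∣≡t)
  -- The preimage of `b` under the inverse of `π` is its image under `π`.
  = preimage (flip π) b
  , ( subst (Block S) (sym (preimage-flip π b)) Bb
    , subst (_⊆ preimage (flip π) b) (preimage-flip (flip π) s) (preimage-⊆ (flip π) s⊆b))
  , λ {c} (Bc , s⊆c) →
      trans (cong (preimage (flip π)) (unique (Bc , preimage-⊆ π s⊆c))) (preimage-flip (flip π) c)

-- Verification by evaluation

every : ∀ n → (Subset n → Bool) → Bool
every zero    p = p []
every (suc n) p = every n (p ∘ (false ∷_)) ∧ every n (p ∘ (true ∷_))

every-sound : ∀ (p : Subset n → Bool) → every n p ≡ true → ∀ b → T (p b)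
every-sound p ok [] = Equivalence.from T-≡ ok
every-sound {suc n} p ok (x ∷ b) with every n (p ∘ (false ∷_)) in eq
every-sound p ok (false ∷ b) | true =
  every-sound (p ∘ (false ∷_)) eq b
every-sound p ok (true ∷ b) | true = every-sound (p ∘ (true ∷_)) ok b

-- The left disjunct settles subsets of other sizes, so `p` is evaluated only at size `k`.
everyOfSize : ∀ n → ℕ → (Subset n → Bool) → Bool
everyOfSize n k p = every n (λ b → not (∣ b ∣ ≡ᵇ k) ∨ p b)

everyOfSize-sound : ∀ (p : Subset n → Bool) → everyOfSize n k p ≡ true → ∀ b → ∣ b ∣ ≡ k → T (p b)
everyOfSize-sound {k = k} p ok b ∣b∣≡k
  with ∣ b ∣ ≡ᵇ k | ≡⇒≡ᵇ ∣ b ∣ k ∣b∣≡k | every-sound (λ c → not (∣ c ∣ ≡ᵇ k) ∨ p c) ok b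
... | true | _ | pb = pb

-- Families of subsets are stored as binary tries, so that membership can be
-- evaluated in at most n steps.
data Trie : ℕ → Set where
  empty : Trie n
  tip   : Trie 0
  node  : Trie n → Trie n → Trie (suc n)

insert : Subset n → Trie n → Trie n
insert []          _          = tip
insert (false ∷ b) empty      = node (insert b empty) empty
insert (true  ∷ b) empty      = node empty (insert b empty)
insert (false ∷ b) (node l r) = node (insert b l) r
insert (true  ∷ b) (node l r) = node l (insert b r)

member : Trie n → Subset n → Bool
member empty      _           = false
member tip        _           = true
member (node l r) (false ∷ b) = member l b
member (node l r) (true  ∷ b) = member r b

supersets : Trie n → Subset n → List (Subset n)
supersets empty      _           = []
supersets tip        _           = [] ∷ []
supersets (node l r) (false ∷ s) =
  List.map (false ∷_) (supersets l s) ++ List.map (true ∷_) (supersets r s)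
supersets (node l r) (true ∷ s)  = List.map (true ∷_) (supersets r s)

∈-supersets⁺ : ∀ (τ : Trie n) {s b} → T (member τ b) → s ⊆ b → b ∈ supersets τ s
∈-supersets⁺ tip {[]} {[]} _ _ = here refl
∈-supersets⁺ (node l r) {false ∷ s} {false ∷ b} m s⊆b =
  ∈-++⁺ˡ (∈-map⁺ (false ∷_) (∈-supersets⁺ l m (drop-∷-⊆ s⊆b)))
∈-supersets⁺ (node l r) {false ∷ s} {true ∷ b} m s⊆b =
  ∈-++⁺ʳ _ (∈-map⁺ (true ∷_) (∈-supersets⁺ r m (drop-∷-⊆ s⊆b)))
∈-supersets⁺ (node l r) {true ∷ s} {true ∷ b} m s⊆b =
  ∈-map⁺ (true ∷_) (∈-supersets⁺ r m (drop-∷-⊆ s⊆b))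
∈-supersets⁺ (node l r) {true ∷ s} {false ∷ b} m s⊆b with () ← []=⇒lookup (s⊆b Vec.here)

∈-supersets⁻ : ∀ (τ : Trie n) {s b} → b ∈ supersets τ s → T (member τ b) × s ⊆ b
∈-supersets⁻ tip {[]} {[]} _ = _ , ⊆-refl
∈-supersets⁻ (node l r) {false ∷ s} b∈ with ∈-++⁻ (List.map (false ∷_) (supersets l s)) b∈
... | inj₁ b∈l with c , c∈ , refl ← ∈-map⁻ (false ∷_) b∈l
  with m , s⊆c ← ∈-supersets⁻ l c∈
  = m , out⊆ s⊆c
... | inj₂ b∈r with c , c∈ , refl ← ∈-map⁻ (true ∷_) b∈r
  with m , s⊆c ← ∈-supersets⁻ r c∈
  = m , out⊆ s⊆c
∈-supersets⁻ (node l r) {true ∷ s} b∈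
  with c , c∈ , refl ← ∈-map⁻ (true ∷_) b∈
  with m , s⊆c ← ∈-supersets⁻ r c∈
  = m , s⊆s s⊆c

isSingleton : ∀ {A : Set} → List A → Bool
isSingleton (_ ∷ []) = true
isSingleton _        = false

-- Soundness of `supersets` makes the single entry a block containing `s`; completeness puts every
-- such block into the list.
uniqueSuperset : ∀ (τ : Trie n) s → T (isSingleton (supersets τ s)) →
                 ∃! _≡_ λ b → T (member τ b) × s ⊆ b
uniqueSuperset τ s ok
  with supersets τ s | ∈-supersets⁺ τ {s} | ∈-supersets⁻ τ {s}
... | b ∷ [] | complete | sound = b , sound (here refl) , λ (m , s⊆c) → only (complete m s⊆c)
  where
  only : ∀ {c} → c ∈ (b ∷ []) → b ≡ c
  only (here refl) = refl

sizesAre : ℕ → Trie n → Bool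
sizesAre k τ = every _ (λ b → not (member τ b) ∨ (∣ b ∣ ≡ᵇ k))

coversOnce : ℕ → Trie n → Bool
coversOnce t τ = everyOfSize _ t (λ s → isSingleton (supersets τ s))

fromTrie : ∀ (τ : Trie n) → sizesAre k τ ≡ true → coversOnce t τ ≡ true → SteinerSystem t k n
fromTrie τ _ _ .Block  b = T (member τ b)
fromTrie τ _ _ .block? b = T? (member τ b)
fromTrie {k = k} τ sizes _ .block-size {b} Bb
  with member τ b | every-sound (λ c → not (member τ c) ∨ (∣ c ∣ ≡ᵇ k)) sizes b
... | true | ∣b∣≡ᵇk = ≡ᵇ⇒≡ ∣ b ∣ k ∣b∣≡ᵇk
fromTrie τ _ covers .covering s ∣s∣≡t =
  uniqueSuperset τ s (everyOfSize-sound (λ c → isSingleton (supersets τ c)) covers s ∣s∣≡t)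

occurrences : Trie n → List (Vec (Fin n) n) → Subset n → ℕ
occurrences τ []       b = 0
occurrences τ (v ∷ vs) b = indicator (member τ (Vec.map (lookup b) v)) + occurrences τ vs b

-- Taking τ and vs as arguments lets call-by-need share them between all b;
-- global constants would be re-evaluated at every occurrence.
occursOften : ℕ → ℕ → Trie n → List (Vec (Fin n) n) → Bool
occursOften k μ τ vs = everyOfSize _ k (λ b → occurrences τ vs b ≡ᵇ μ)

module _ (τ : Trie n) (sizes : sizesAre k τ ≡ true) (covers : coversOnce t τ ≡ true) where

  relabellings : List (Permutation′ n) → List (SteinerSystem t k n)
  relabellings = List.map (λ π → relabel π (fromTrie τ sizes covers))

  length-filter-relabellings : ∀ πs b →
    length (filter (λ S → block? S b) (relabellings πs)) ≡ occurrences τ (List.map image πs) b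
  length-filter-relabellings [] b = refl
  length-filter-relabellings (π ∷ πs) b with member τ (preimage π b)
  ... | true  = cong suc (length-filter-relabellings πs b)
  ... | false = length-filter-relabellings πs b

  relabellingsᴸ : ∀ πs → occursOften k μ τ (List.map image πs) ≡ true → LargeSet t k n μ
  relabellingsᴸ πs ok .systems = relabellings πs
  relabellingsᴸ {μ} πs ok .multiplicity b ∣b∣≡k = trans (length-filter-relabellings πs b)
    (≡ᵇ⇒≡ _ μ (everyOfSize-sound (λ c → occurrences τ (List.map image πs) c ≡ᵇ μ) ok b ∣b∣≡k))

-- Permutations and systems on 12 points

cycle : List (Fin n) → Permutation′ n
-- As `_∘ₚ_` applies its left argument first, distinct entries each go to the next one and the last
-- goes to the first.
cycle (i ∷ j ∷ is) = cycle (j ∷ is) ∘ₚ transpose i j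
cycle _            = Perm.id

powers : ℕ → Permutation′ n → List (Permutation′ n)
powers zero    π = []
powers (suc m) π = Perm.id ∷ List.map (_∘ₚ π) (powers m π)

infixl 6 _⊙_
_⊙_ : List (Permutation′ n) → List (Permutation′ n) → List (Permutation′ n)
_⊙_ = cartesianProductWith _∘ₚ_

-- Point i ≤ 10 stands for the residue i modulo 11 and point 11 for ∞.
fromElements : List (Fin 12) → Subset 12
fromElements = ⋃ ∘ List.map ⁅_⁆

translation : Permutation′ 12
translation = cycle (# 0 ∷ # 1 ∷ # 2 ∷ # 3 ∷ # 4 ∷ # 5 ∷ # 6 ∷ # 7 ∷ # 8 ∷ # 9 ∷ # 10 ∷ [])

-- x ↦ 3 x generates multiplication by the nonzero squares.
tripling : Permutation′ 12
tripling = cycle (# 1 ∷ # 3 ∷ # 9 ∷ # 5 ∷ # 4 ∷ []) ∘ₚ cycle (# 2 ∷ # 6 ∷ # 7 ∷ # 10 ∷ # 8 ∷ [])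

negation : Permutation′ 12
negation = transpose (# 1) (# 10) ∘ₚ transpose (# 2) (# 9) ∘ₚ transpose (# 3) (# 8)
        ∘ₚ transpose (# 4) (# 7) ∘ₚ transpose (# 5) (# 6)

-- A cyclic S(4,5,11) extended by ∞, together with the complements of its blocks.
hexads : List (Subset 12)
hexads = List.map ∁ hexads∞ ++ hexads∞
  where
  ∞ : Fin 12
  ∞ = # 11
  hexads∞ =
    -- The nonzero squares have 11 translates, and the second base block has 55 images under x ↦ s x
    -- + c with s a nonzero square: the 66 blocks of an S(4,5,11).
    List.map (λ π → preimage π (fromElements (∞ ∷ # 1 ∷ # 3 ∷ # 4 ∷ # 5 ∷ # 9 ∷ [])))
             (powers 11 translation) ++
    List.map (λ π → preimage π (fromElements (∞ ∷ # 0 ∷ # 1 ∷ # 2 ∷ # 3 ∷ # 5 ∷ [])))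
             (powers 11 translation ⊙ powers 5 tripling)

hexadTrie : Trie 12
hexadTrie = List.foldr insert empty hexads

-- Each system contains 132 of the 924 subsets of size 6, so multiplicity μ takes 7 μ systems: 14 =
-- 1 + 2 + 11 here and 105 in `relabellings₁₅`.
relabellings₂ : List (Permutation′ 12)
relabellings₂ = Perm.id ∷ negation ∷ negation ∷
  ((cycle (# 0 ∷ # 2 ∷ # 3 ∷ # 9 ∷ # 1 ∷ []) ∷ []) ⊙ powers 11 translation)

-- The orbit of one relabelling under the direct product, of order 105, of the
-- Frobenius group 7:3 on the points 0,…,6 and a cyclic group on 7,…,11.
relabellings₁₅ : List (Permutation′ 12)
relabellings₁₅ = (transpose (# 0) (# 3) ∷ [])
  ⊙ powers 3 (cycle (# 1 ∷ # 2 ∷ # 4 ∷ []) ∘ₚ cycle (# 3 ∷ # 6 ∷ # 5 ∷ []))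
  ⊙ powers 7 (cycle (# 0 ∷ # 1 ∷ # 2 ∷ # 3 ∷ # 4 ∷ # 5 ∷ # 6 ∷ []))
  ⊙ powers 5 (cycle (# 7 ∷ # 8 ∷ # 9 ∷ # 10 ∷ # 11 ∷ []))

hexadSizes : sizesAre 6 hexadTrie ≡ true
hexadSizes = refl

hexadCovers : coversOnce 5 hexadTrie ≡ true
hexadCovers = refl

hexadOccurrences₂ : occursOften 6 2 hexadTrie (List.map image relabellings₂) ≡ true
hexadOccurrences₂ = refl

hexadOccurrences₁₅ : occursOften 6 15 hexadTrie (List.map image relabellings₁₅) ≡ true
hexadOccurrences₁₅ = refl

largeSet₂ : LargeSet 5 6 12 2
largeSet₂ = relabellingsᴸ {k = 6} {t = 5} hexadTrie hexadSizes hexadCovers {μ = 2} relabellings₂ hexadOccurrences₂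

largeSet₁₅ : LargeSet 5 6 12 15
largeSet₁₅ = relabellingsᴸ {k = 6} {t = 5} hexadTrie hexadSizes hexadCovers {μ = 15} relabellings₁₅ hexadOccurrences₁₅

-- Combination into all multiplicities

evenLargeSet : ∀ m → LargeSet 5 6 12 (m * 2)
evenLargeSet m = m ×ᴸ largeSet₂

-- With 1 among the exceptions, all odd numbers below 15 are excluded uniformly; `largeSet` rules
-- out 1 by `2 ≤ μ`.
oddLargeSet : ∀ m → suc (m * 2) ∉ (1 ∷ 3 ∷ 5 ∷ 7 ∷ 9 ∷ 11 ∷ 13 ∷ []) →
              LargeSet 5 6 12 (suc (m * 2))
oddLargeSet 0 ∉ = ⊥-elim (∉ (here refl))
oddLargeSet 1 ∉ = ⊥-elim (∉ (there (here refl)))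
oddLargeSet 2 ∉ = ⊥-elim (∉ (there (there (here refl))))
oddLargeSet 3 ∉ = ⊥-elim (∉ (there (there (there (here refl)))))
oddLargeSet 4 ∉ = ⊥-elim (∉ (there (there (there (there (here refl))))))
oddLargeSet 5 ∉ = ⊥-elim (∉ (there (there (there (there (there (here refl)))))))
oddLargeSet 6 ∉ = ⊥-elim (∉ (there (there (there (there (there (there (here refl))))))))
-- The multiplicity `suc ((7 + m) * 2)` computes to `15 + m * 2`.
oddLargeSet (suc (suc (suc (suc (suc (suc (suc m))))))) _ = largeSet₁₅ ⊎ᴸ evenLargeSet m

even⊎odd : ∀ μ → (∃ λ m → μ ≡ m * 2) ⊎ (∃ λ m → μ ≡ suc (m * 2))
even⊎odd zero = inj₁ (0 , refl)
even⊎odd (suc μ) with even⊎odd μ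
... | inj₁ (m , refl) = inj₂ (m , refl)
... | inj₂ (m , refl) = inj₁ (suc m , refl)

largeSet : ∀ μ → 2 ≤ μ → μ ∉ (3 ∷ 5 ∷ 7 ∷ 9 ∷ 11 ∷ 13 ∷ []) → LargeSet 5 6 12 μ
largeSet μ 2≤μ μ∉ with even⊎odd μ
... | inj₁ (m , refl) = evenLargeSet m
... | inj₂ (m , refl) = oddLargeSet m λ where
  (here μ≡1) → <⇒≢ 2≤μ (sym μ≡1)
  (there μ∈) → μ∉ μ∈

theorem23 : ∀ (μ : ℕ) → 2 ≤ μ → μ ∉ (3 ∷ 5 ∷ 7 ∷ 9 ∷ 11 ∷ 13 ∷ []) →
    LargeSet 4 5 11 μ × LargeSet 5 6 12 μ
theorem23 μ 2≤μ μ∉ = derivedᴸ (largeSet μ 2≤μ μ∉) , largeSet μ 2≤μ μ∉
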